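{- Let $M$ be a finite ordinal monoid, $\Sigma$ a finite alphabet, $\mu:\Sigma\to M$, $F_K,F_L\subseteq M$, and let $K$ (resp. $L$) be the language recognised by $(M,\mu,F_K)$ (resp. $(M,\mu,F_L)$). Suppose there is $X\in\mathrm{Sat}$ with $X\cap F_K\neq\varnothing$ and $X\cap F_L\neq\varnothing$. Then there is a computable function which, for any first-order sentence $\varphi$, computes a pair of words $(u,u')\in K\times L$ such that $u\models\varphi$ if and only if $u'\models\varphi$. In particular $K$ and $L$ cannot be separated by a first-order definable language.
   Context: Countable ordinal words over $X$: maps from a countable ordinal to $X$; $X^{\mathrm{ord}}$ is their set, $X^+$ the finite nonempty ones. An ordinal monoid is $(M,\pi)$ with $\pi:M^{\mathrm{ord}}\to M$, $\pi(x)=x$ on one-letter words, and generalised associativity $\pi((\pi(u_\iota))_{\iota<\alpha})=\pi(u_0u_1\cdots)$. Write $1=\pi(\varepsilon)$, $x\cdot y=\pi(xy)$, $x^\omega=\pi(xxx\cdots)$. $(M,\mu,F)$ recognises $\{u\in\Sigma^{\mathrm{ord}}:\pi(\tilde\mu(u))\in F\}$, $\tilde\mu$ the letterwise extension of $\mu$. The power ordinal monoid $\mathcal P(M)$ has operations $X\cdot Y=\{xy:x\in X,y\in Y\}$, $X^\omega=\{u\cdot v^\omega:u,v\in X^+\}$, unit $\{1\}$. For $x$ in a finite semigroup, $x^{\mathrm{idem}+k}$ is the eventual value of $x^{n!+k}$, and $X^{\mathrm{merge}}=\bigcup_{k\in\mathbb N}X^{\mathrm{idem}+k}$ (in $\mathcal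 P(M)$). $\mathrm{Sat}$ is the least subset of $\mathcal P(M)$ containing $\{1\}$ and all $\{\mu(a)\}$, $a\in\Sigma$, and closed under $\cdot$, $-^\omega$, $-^{\mathrm{merge}}$. First-order sentences use $<$ and letter predicates $a(x)$, interpreted on positions of words. -}

module Defs where

open import Level using (Level; _⊔_) renaming (suc to lsuc; zero to 0ℓ)
open import Data.Nat as ℕ using (ℕ; zero; suc; _≤_)
open import Data.Nat.Properties using (<-trans; <-cmp)
open import Data.Nat.Induction using (<-wellFounded)
open import Data.Nat.Base using (_!)
open import Data.Fin using (Fin)
open import Data.Bool using (Bool; true; false)
open import Data.Unit using (⊤; tt)
open import Data.Empty using (⊥)
open import Data.Product using (Σ; _×_; _,_; proj₁; proj₂)
open import Data.Sum using (_⊎_)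
open import Relation.Binary.Core using (Rel)
open import Relation.Binary.Definitions using (Transitive; Trichotomous; Tri; tri<; tri≈; tri>)
open import Relation.Binary.PropositionalEquality using (_≡_; refl; subst)
open import Induction.WellFounded using (WellFounded; Acc; acc)
open import Function using (_∘_)
open import Relation.Unary using (Pred)

private variable a : Level

-- The order type of the
-- positions is the (countable) ordinal which is the domain of the word.

record Word (A : Set a) : Set (lsuc 0ℓ ⊔ a) where
  field
    Pos     : Set
    _<_     : Rel Pos 0ℓ
    trans   : Transitive _<_
    compare : Trichotomous _≡_ _<_
    wf      : WellFounded _<_
    enc     : Pos → ℕ
    enc-inj : ∀ p q → enc p ≡ enc q → p ≡ q
    letter  : Pos → A

open Word public

mapW : {A : Set a} {b : Level} {B : Set b} → (A → B) → Word A → Word B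
mapW f w = record
  { Pos = Pos w ; _<_ = _<_ w ; trans = trans w ; compare = compare w
  ; wf = wf w ; enc = enc w ; enc-inj = enc-inj w ; letter = f ∘ letter w }

Lex : {A : Set a} (w : Word (Word A)) →
      Σ (Pos w) (λ i → Pos (letter w i)) → Σ (Pos w) (λ i → Pos (letter w i)) → Set
Lex w (i , p) (j , q) =
  _<_ w i j ⊎ Σ (i ≡ j) (λ e → _<_ (letter w j) (subst (λ k → Pos (letter w k)) e p) q)

IsConcat : {A : Set a} → Word (Word A) → Word A → Set a
IsConcat {A = A} w v =
  Σ (Pos v → Σ (Pos w) (λ i → Pos (letter w i))) λ f →
      (∀ p q → f p ≡ f q → p ≡ q)
    × (∀ y → Σ (Pos v) (λ p → f p ≡ y))
    × (∀ p q → (_<_ v p q → Lex w (f p) (f q)) × (Lex w (f p) (f q) → _<_ v p q))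
    × (∀ p → letter v p ≡ letter (letter w (proj₁ (f p))) (proj₂ (f p)))

emptyW : {A : Set a} → Word A
emptyW = record
  { Pos = ⊥ ; _<_ = λ _ _ → ⊥ ; trans = λ () ; compare = λ ()
  ; wf = λ () ; enc = λ () ; enc-inj = λ () ; letter = λ () }

oneW : {A : Set a} → A → Word A
oneW x = record
  { Pos = ⊤ ; _<_ = λ _ _ → ⊥ ; trans = λ ()
  ; compare = λ { tt tt → tri≈ (λ ()) refl (λ ()) }
  ; wf = λ _ → acc (λ ()) ; enc = λ _ → 0 ; enc-inj = λ { tt tt _ → refl }
  ; letter = λ _ → x }

data _<B_ : Bool → Bool → Set where
  f<t : false <B true

private
  <B-trans : Transitive _<B_
  <B-trans f<t ()

  <B-cmp : Trichotomous _≡_ _<B_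
  <B-cmp false false = tri≈ (λ ()) refl (λ ())
  <B-cmp false true  = tri< f<t (λ ()) (λ ())
  <B-cmp true  false = tri> (λ ()) (λ ()) f<t
  <B-cmp true  true  = tri≈ (λ ()) refl (λ ())

  accF : Acc _<B_ false
  accF = acc (λ ())

  <B-wf : WellFounded _<B_
  <B-wf false = accF
  <B-wf true  = acc (λ { f<t → accF })

  encB : Bool → ℕ
  encB false = 0
  encB true  = 1

  encB-inj : ∀ p q → encB p ≡ encB q → p ≡ q
  encB-inj false false _ = refl
  encB-inj false true  ()
  encB-inj true  false ()
  encB-inj true  true  _ = refl

twoW : {A : Set a} → A → A → Word A
twoW x y = record
  { Pos = Bool ; _<_ = _<B_ ; trans = <B-trans ; compare = <B-cmp
  ; wf = <B-wf ; enc = encB ; enc-inj = encB-inj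
  ; letter = λ { false → x ; true → y } }

omegaW : {A : Set a} → A → Word A
omegaW x = record
  { Pos = ℕ ; _<_ = ℕ._<_ ; trans = <-trans ; compare = <-cmp
  ; wf = <-wellFounded ; enc = λ n → n ; enc-inj = λ _ _ e → e
  ; letter = λ _ → x }

record OrdinalMonoid : Set₁ where
  field
    Carrier     : Set
    π           : Word Carrier → Carrier
    π-one       : ∀ x → π (oneW x) ≡ x
    π-assoc     : ∀ (w : Word (Word Carrier)) (v : Word Carrier) →
                  IsConcat w v → π (mapW π w) ≡ π v

  𝟙 : Carrier
  𝟙 = π emptyW

  _·_ : Carrier → Carrier → Carrier
  x · y = π (twoW x y)

  _^ω : Carrier → Carrier
  x ^ω = π (omegaW x)

  _⊙_ : Pred Carrier 0ℓ → Pred Carrier 0ℓ → Pred Carrier 0ℓ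
  (X ⊙ Y) m = Σ Carrier λ x → Σ Carrier λ y → X x × Y y × (x · y ≡ m)

  powP : Pred Carrier 0ℓ → ℕ → Pred Carrier 0ℓ
  powP X zero m = m ≡ 𝟙
  powP X (suc zero) = X
  powP X (suc (suc n)) = powP X (suc n) ⊙ X

  plusP : Pred Carrier 0ℓ → Pred Carrier 0ℓ
  plusP X m = Σ ℕ λ n → powP X (suc n) m

  omegaP : Pred Carrier 0ℓ → Pred Carrier 0ℓ
  omegaP X m = Σ Carrier λ u → Σ Carrier λ v →
               plusP X u × plusP X v × (u · (v ^ω) ≡ m)

  idemP : Pred Carrier 0ℓ → ℕ → Pred Carrier 0ℓ
  idemP X k m = Σ ℕ λ N → ∀ n → N ≤ n → powP X ((n !) ℕ.+ k) m

  mergeP : Pred Carrier 0ℓ → Pred Carrier 0ℓ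
  mergeP X m = Σ ℕ λ k → idemP X k m

record FiniteOrdinalMonoid : Set₁ where
  field
    monoid  : OrdinalMonoid
  open OrdinalMonoid monoid public
  field
    size    : ℕ
    toFin   : Carrier → Fin size
    fromFin : Fin size → Carrier
    from∘to : ∀ x → fromFin (toFin x) ≡ x
    to∘from : ∀ i → toFin (fromFin i) ≡ i

record IsFinite (S : Set) : Set where
  field
    size    : ℕ
    toFin   : S → Fin size
    fromFin : Fin size → S
    from∘to : ∀ x → fromFin (toFin x) ≡ x
    to∘from : ∀ i → toFin (fromFin i) ≡ i

-- Sat: least subset of P(M) containing {1}, {μ(a)} and closed under
-- ·, ω, merge.  Elements of Sat are the denotations of these terms.

module _ (M : FiniteOrdinalMonoid) {Σ' : Set} (μ : Σ' → FiniteOrdinalMonoid.Carrier M) where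
  open FiniteOrdinalMonoid M

  data SatTerm : Set where
    unit  : SatTerm
    lett  : Σ' → SatTerm
    _⊗_   : SatTerm → SatTerm → SatTerm
    omg   : SatTerm → SatTerm
    mrg   : SatTerm → SatTerm

  ⟦_⟧ : SatTerm → Pred Carrier 0ℓ
  ⟦ unit ⟧ m = m ≡ 𝟙
  ⟦ lett a ⟧ m = m ≡ μ a
  ⟦ s ⊗ t ⟧ = ⟦ s ⟧ ⊙ ⟦ t ⟧
  ⟦ omg t ⟧ = omegaP ⟦ t ⟧
  ⟦ mrg t ⟧ = mergeP ⟦ t ⟧

  InSat : Pred Carrier 0ℓ → Set
  InSat X = Σ SatTerm λ t → ∀ m → (⟦ t ⟧ m → X m) × (X m → ⟦ t ⟧ m)

  Recognised : Pred Carrier 0ℓ → Word Σ' → Set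
  Recognised F u = F (π (mapW μ u))

data Formula (Σ' : Set) : ℕ → Set where
  _<ᶠ_  : ∀ {n} → Fin n → Fin n → Formula Σ' n
  _≡ᶠ_  : ∀ {n} → Fin n → Fin n → Formula Σ' n
  lab   : ∀ {n} → Σ' → Fin n → Formula Σ' n
  ¬ᶠ_   : ∀ {n} → Formula Σ' n → Formula Σ' n
  _∧ᶠ_  : ∀ {n} → Formula Σ' n → Formula Σ' n → Formula Σ' n
  ∃ᶠ    : ∀ {n} → Formula Σ' (suc n) → Formula Σ' n

Sentence : Set → Set
Sentence Σ' = Formula Σ' 0

extend : {P : Set} {n : ℕ} → P → (Fin n → P) → Fin (suc n) → P
extend p ρ Fin.zero = p
extend p ρ (Fin.suc i) = ρ i

Sat⟨_⊨_[_]⟩ : {Σ' : Set} (u : Word Σ') {n : ℕ} → Formula Σ' n → (Fin n → Pos u) → Set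
Sat⟨ u ⊨ i <ᶠ j [ ρ ]⟩ = _<_ u (ρ i) (ρ j)
Sat⟨ u ⊨ i ≡ᶠ j [ ρ ]⟩ = ρ i ≡ ρ j
Sat⟨ u ⊨ lab a i [ ρ ]⟩ = letter u (ρ i) ≡ a
Sat⟨ u ⊨ ¬ᶠ φ [ ρ ]⟩ = Sat⟨ u ⊨ φ [ ρ ]⟩ → ⊥
Sat⟨ u ⊨ φ ∧ᶠ ψ [ ρ ]⟩ = Sat⟨ u ⊨ φ [ ρ ]⟩ × Sat⟨ u ⊨ ψ [ ρ ]⟩
Sat⟨ u ⊨ ∃ᶠ φ [ ρ ]⟩ = Σ (Pos u) λ p → Sat⟨ u ⊨ φ [ extend p ρ ]⟩

_⊨_ : {Σ' : Set} → Word Σ' → Sentence Σ' → Set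
u ⊨ φ = Sat⟨ u ⊨ φ [ (λ ()) ]⟩

{-# OPTIONS --safe #-}
module Submission where

-- Pick m_K ∈ X ∩ F_K and m_L ∈ X ∩ F_L. Following a Sat-term for X, every m ∈ X and every
-- rank r get a word w_r(m) of value m: products are concatenated, X^ω = X⁺(X⁺)^ω is realised
-- as u v^ω, and X^merge as a product of at least 2^r − 1 factors. Any two words built for the
-- same term are equivalent for the r-round Ehrenfeucht–Fraïssé game, because games compose
-- along concatenations, zⁿ z^ω and (zⁿ)^ω are isomorphic to z^ω, and concatenations of
-- equivalent blocks are equivalent once their numbers of blocks agree or both exceed 2^r − 1.
-- So for φ of quantifier rank r, w_r(m_K) ∈ K and w_r(m_L) ∈ L agree on φ.

open import Defs
open import Level using (Level; 0ℓ)
open import Data.Nat as ℕ using (ℕ; zero; suc; _+_; _*_; _∸_; _≤_; z≤n; s≤s; z<s; _<?_; _!; NonZero)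
  renaming (_<_ to _<ℕ_)
open import Data.Nat.Properties
  using (<-cmp; <⇒≢; <-asym; <-≤-trans; ≤-trans; ≤-refl; ≤-reflexive; ≮⇒≥; n≤1+n; m≤m+n; m≤n+m;
         m≤m⊔n; m≤n⊔m; +-comm; +-suc; +-mono-≤; +-monoʳ-≤; +-monoˡ-<; +-cancelˡ-≡; +-cancelʳ-≡;
         *-identityʳ; *-monoˡ-≤; *-monoʳ-≤; m∸n+n≡m; m+n≤o⇒m≤o∸n; suc-injective; 1≤n!;
         module ≤-Reasoning)
open import Data.Nat.DivMod using (DivMod; result; _divMod_)
open import Data.Fin using (Fin; zero; suc; toℕ)
open import Data.Fin.Properties using (toℕ<n; toℕ-injective)
open import Data.Bool using (Bool; true; false; if_then_else_)
open import Data.Unit using (tt)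
open import Data.Empty using (⊥; ⊥-elim)
open import Data.Product using (Σ; _×_; _,_; proj₁; proj₂; map; map₁; map₂; uncurry; swap)
open import Data.Maybe using (Maybe; just; nothing) renaming (map to mapᴹ)
open import Data.Sum using (_⊎_; inj₁; inj₂; [_,_])
open import Data.List using (List; []; _∷_; _++_; foldr; length; replicate)
open import Data.List.Properties using (length-++; length-replicate)
open import Data.List.Relation.Unary.All as All using (All; []; _∷_)
open import Data.List.Relation.Unary.All.Properties using (++⁻; ++⁺; replicate⁺)
open import Function using (_∘_; id)
open import Induction.WellFounded using (WellFounded; Acc; acc)
open import Relation.Binary.Definitions using (Transitive; Trichotomous; DecidableEquality; tri<; tri≈; tri>)
open import Relation.Binary.PropositionalEquality
  using (_≡_; _≗_; refl; sym; cong; cong₂; subst; subst₂; module ≡-Reasoning)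
  renaming (trans to ≡-trans)
open import Relation.Nullary using (¬_; yes; no)
open import Relation.Unary using (Pred)

private variable
  a b : Level
  A : Set

-- Cantor pairing, used to encode the positions of a concatenation into ℕ.

triangle : ℕ → ℕ
triangle zero    = zero
triangle (suc n) = suc n + triangle n

triangle-mono-≤ : ∀ {m n} → m ≤ n → triangle m ≤ triangle n
triangle-mono-≤ {zero}  _         = z≤n
triangle-mono-≤ {suc m} (s≤s m≤n) = +-mono-≤ (s≤s m≤n) (triangle-mono-≤ m≤n)

triangle+<triangle-suc : ∀ {s b} → b ≤ s → triangle s + b <ℕ triangle (suc s)
triangle+<triangle-suc {s} {b} b≤s = s≤s (begin
  triangle s + b  ≤⟨ +-monoʳ-≤ (triangle s) b≤s ⟩
  triangle s + s  ≡⟨ +-comm (triangle s) s ⟩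
  s + triangle s  ∎)
  where open ≤-Reasoning

triangle+<triangle+ : ∀ {s t b c} → b ≤ s → s <ℕ t → triangle s + b <ℕ triangle t + c
triangle+<triangle+ {t = t} {c = c} b≤s s<t =
  <-≤-trans (triangle+<triangle-suc b≤s) (≤-trans (triangle-mono-≤ s<t) (m≤m+n (triangle t) c))

triangle+-injectiveˡ : ∀ {s t b c} → b ≤ s → c ≤ t → triangle s + b ≡ triangle t + c → s ≡ t
triangle+-injectiveˡ {s} {t} b≤s c≤t e with <-cmp s t
... | tri< s<t _ _ = ⊥-elim (<⇒≢ (triangle+<triangle+ b≤s s<t) e)
... | tri≈ _ s≡t _ = s≡t
... | tri> _ _ t<s = ⊥-elim (<⇒≢ (triangle+<triangle+ c≤t t<s) (sym e))

pair : ℕ → ℕ → ℕ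
pair m n = triangle (m + n) + n

pair-injective : ∀ {m n m′ n′} → pair m n ≡ pair m′ n′ → m ≡ m′ × n ≡ n′
pair-injective {m} {n} {m′} {n′} e = +-cancelʳ-≡ n m m′ (≡-trans sums (cong (m′ +_) (sym n≡n′))) , n≡n′
  where
  sums : m + n ≡ m′ + n′
  sums = triangle+-injectiveˡ (m≤n+m n m) (m≤n+m n′ m′) e
  n≡n′ : n ≡ n′
  n≡n′ = +-cancelˡ-≡ (triangle (m′ + n′)) n n′ (≡-trans (cong (λ k → triangle k + n) (sym sums)) e)

-- Concatenation and isomorphism of words

<-irreflexive : (u : Word A) {x : Pos u} → ¬ _<_ u x x
<-irreflexive u {x} x<x with compare u x x
... | tri< _ x≢x _ = x≢x refl
... | tri≈ x≮x _ _ = x≮x x<x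
... | tri> _ x≢x _ = x≢x refl

relabel : {B : Set a} {C : Set b} (J : Word B) → (Pos J → C) → Word C
relabel J f = record
  { Pos = Pos J ; _<_ = _<_ J ; trans = trans J ; compare = compare J
  ; wf = wf J ; enc = enc J ; enc-inj = enc-inj J ; letter = f }

module _ (w : Word (Word A)) where
  private
    Pos∑ : Set
    Pos∑ = Σ (Pos w) (λ i → Pos (letter w i))

  Lex-trans : Transitive (Lex w)
  Lex-trans (inj₁ i<j)         (inj₁ j<k)         = inj₁ (trans w i<j j<k)
  Lex-trans (inj₁ i<j)         (inj₂ (refl , _))  = inj₁ i<j
  Lex-trans (inj₂ (refl , _))  (inj₁ j<k)         = inj₁ j<k
  Lex-trans {i , _} (inj₂ (refl , p<q)) (inj₂ (refl , q<r)) = inj₂ (refl , trans (letter w i) p<q q<r)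

  Lex-compare : Trichotomous _≡_ (Lex w)
  Lex-compare (i , p) (j , q) with compare w i j
  ... | tri< i<j i≢j j≮i = tri< (inj₁ i<j) (i≢j ∘ cong proj₁) [ j≮i , i≢j ∘ sym ∘ proj₁ ]
  ... | tri> i≮j i≢j j<i = tri> [ i≮j , i≢j ∘ proj₁ ] (i≢j ∘ cong proj₁) (inj₁ j<i)
  ... | tri≈ i≮i refl _ with compare (letter w i) p q
  ...   | tri< p<q p≢q q≮p =
    tri< (inj₂ (refl , p<q)) (λ { refl → p≢q refl }) [ i≮i , (λ { (refl , q<p) → q≮p q<p }) ]
  ...   | tri≈ p≮p refl _ =
    tri≈ [ i≮i , (λ { (refl , p<p) → p≮p p<p }) ] refl [ i≮i , (λ { (refl , p<p) → p≮p p<p }) ]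
  ...   | tri> p≮q p≢q q<p =
    tri> [ i≮i , (λ { (refl , p<q) → p≮q p<q }) ] (λ { refl → p≢q refl }) (inj₂ (refl , q<p))

  Lex-acc : ∀ {i} → Acc (_<_ w) i → ∀ {p} → Acc (_<_ (letter w i)) p → Acc (Lex w) (i , p)
  Lex-acc {i} (acc rec-i) = inner
    where
    inner : ∀ {p} → Acc (_<_ (letter w i)) p → Acc (Lex w) (i , p)
    inner {p} (acc rec-p) = acc below
      where
      below : ∀ {y} → Lex w y (i , p) → Acc (Lex w) y
      below {j , q} (inj₁ j<i)          = Lex-acc (rec-i j<i) (wf (letter w j) q)
      below         (inj₂ (refl , q<p)) = inner (rec-p q<p)

  Lex-wellFounded : WellFounded (Lex w)
  Lex-wellFounded (i , p) = Lex-acc (wf w i) (wf (letter w i) p)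

  encode∑ : Pos∑ → ℕ
  encode∑ (i , p) = pair (enc w i) (enc (letter w i) p)

  encode∑-injective : ∀ x y → encode∑ x ≡ encode∑ y → x ≡ y
  encode∑-injective (i , p) (j , q) e with pair-injective e
  ... | eᵢ , eₚ with enc-inj w i j eᵢ
  ... | refl = cong (i ,_) (enc-inj (letter w i) p q eₚ)

  Concat : Word A
  Concat = record
    { Pos = Pos∑ ; _<_ = Lex w ; trans = Lex-trans ; compare = Lex-compare
    ; wf = Lex-wellFounded ; enc = encode∑ ; enc-inj = encode∑-injective
    ; letter = λ (i , p) → letter (letter w i) p }

Concat-isConcat : (w : Word (Word A)) → IsConcat w (Concat w)
Concat-isConcat w = id , (λ _ _ e → e) , (λ y → y , refl) , (λ _ _ → id , id) , (λ _ → refl)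

ConcatOver : {B : Set} (J : Word B) → (Pos J → Word A) → Word A
ConcatOver J f = Concat (relabel J f)

infix 4 _≅_
record _≅_ (u v : Word A) : Set₁ where
  field
    to        : Pos u → Pos v
    from      : Pos v → Pos u
    from∘to   : ∀ x → from (to x) ≡ x
    to∘from   : ∀ y → to (from y) ≡ y
    to-mono   : ∀ {x y} → _<_ u x y → _<_ v (to x) (to y)
    from-mono : ∀ {x y} → _<_ v x y → _<_ u (from x) (from y)
    to-letter : ∀ x → letter v (to x) ≡ letter u x

open _≅_ public

-- Between strict total orders, a monotone bijection automatically reflects the order.
mk≅ : {u v : Word A} (f : Pos u → Pos v) (g : Pos v → Pos u) →
      (∀ x → g (f x) ≡ x) → (∀ y → f (g y) ≡ y) →
      (∀ {x y} → _<_ u x y → _<_ v (f x) (f y)) → (∀ x → letter v (f x) ≡ letter u x) → u ≅ v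
mk≅ {u = u} {v} f g g∘f f∘g f-mono f-letter = record
  { to = f ; from = g ; from∘to = g∘f ; to∘from = f∘g
  ; to-mono = f-mono ; from-mono = g-mono ; to-letter = f-letter }
  where
  g-mono : ∀ {x y} → _<_ v x y → _<_ u (g x) (g y)
  g-mono {x} {y} x<y with compare u (g x) (g y)
  ... | tri< gx<gy _ _ = gx<gy
  ... | tri≈ _ gx≡gy _ = ⊥-elim (<-irreflexive v (subst (λ z → _<_ v z y) x≡y x<y))
    where
    x≡y : x ≡ y
    x≡y = ≡-trans (sym (f∘g x)) (≡-trans (cong f gx≡gy) (f∘g y))
  ... | tri> _ _ gy<gx =
    ⊥-elim (<-irreflexive v (trans v x<y (subst₂ (_<_ v) (f∘g y) (f∘g x) (f-mono gy<gx))))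

≅-refl : {u : Word A} → u ≅ u
≅-refl = record { to = id ; from = id ; from∘to = λ _ → refl ; to∘from = λ _ → refl
                ; to-mono = id ; from-mono = id ; to-letter = λ _ → refl }

≅-sym : {u v : Word A} → u ≅ v → v ≅ u
≅-sym {v = v} α = record
  { to = from α ; from = to α ; from∘to = to∘from α ; to∘from = from∘to α
  ; to-mono = from-mono α ; from-mono = to-mono α
  ; to-letter = λ y → ≡-trans (sym (to-letter α (from α y))) (cong (letter v) (to∘from α y)) }

≅-trans : {u v w : Word A} → u ≅ v → v ≅ w → u ≅ w
≅-trans α β = record
  { to = to β ∘ to α ; from = from α ∘ from β
  ; from∘to = λ x → ≡-trans (cong (from α) (from∘to β (to α x))) (from∘to α x)
  ; to∘from = λ z → ≡-trans (cong (to β) (to∘from α (from β z))) (to∘from β z)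
  ; to-mono = to-mono β ∘ to-mono α ; from-mono = from-mono α ∘ from-mono β
  ; to-letter = λ x → ≡-trans (to-letter β (to α x)) (to-letter α x) }

≅-mapW : {C : Set} (g : A → C) {u v : Word A} → u ≅ v → mapW g u ≅ mapW g v
≅-mapW g α = record
  { to = to α ; from = from α ; from∘to = from∘to α ; to∘from = to∘from α
  ; to-mono = to-mono α ; from-mono = from-mono α ; to-letter = cong g ∘ to-letter α }

to-reflect : {u v : Word A} (α : u ≅ v) {x y : Pos u} → _<_ v (to α x) (to α y) → _<_ u x y
to-reflect {u = u} α {x} {y} = subst₂ (_<_ u) (from∘to α x) (from∘to α y) ∘ from-mono α

pick : Word A → Word A → Bool → Word A
pick u v false = u
pick u v true  = v

infixr 5 _⊕_
_⊕_ : Word A → Word A → Word A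
u ⊕ v = ConcatOver (twoW tt tt) (pick u v)

ω-power : Word A → Word A
ω-power u = ConcatOver (omegaW tt) (λ _ → u)

cat : List (Word A) → Word A
cat = foldr _⊕_ emptyW

module _ {u u′ v v′ : Word A} (α : u ≅ u′) (β : v ≅ v′) where
  private
    f : Pos (u ⊕ v) → Pos (u′ ⊕ v′)
    f (false , p) = false , to α p
    f (true  , q) = true  , to β q

    g : Pos (u′ ⊕ v′) → Pos (u ⊕ v)
    g (false , p) = false , from α p
    g (true  , q) = true  , from β q

    g∘f : ∀ x → g (f x) ≡ x
    g∘f (false , p) = cong (false ,_) (from∘to α p)
    g∘f (true  , q) = cong (true ,_) (from∘to β q)

    f∘g : ∀ x → f (g x) ≡ x
    f∘g (false , p) = cong (false ,_) (to∘from α p)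
    f∘g (true  , q) = cong (true ,_) (to∘from β q)

    f-mono : ∀ {x y} → _<_ (u ⊕ v) x y → _<_ (u′ ⊕ v′) (f x) (f y)
    f-mono (inj₁ f<t) = inj₁ f<t
    f-mono {false , _} (inj₂ (refl , p<q)) = inj₂ (refl , to-mono α p<q)
    f-mono {true  , _} (inj₂ (refl , p<q)) = inj₂ (refl , to-mono β p<q)

    f-letter : ∀ x → letter (u′ ⊕ v′) (f x) ≡ letter (u ⊕ v) x
    f-letter (false , p) = to-letter α p
    f-letter (true  , q) = to-letter β q

  ⊕-cong : u ⊕ v ≅ u′ ⊕ v′
  ⊕-cong = mk≅ f g g∘f f∘g f-mono f-letter

module _ (u v w : Word A) where
  private
    f : Pos ((u ⊕ v) ⊕ w) → Pos (u ⊕ (v ⊕ w))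
    f (false , false , p) = false , p
    f (false , true  , q) = true , false , q
    f (true  , r)         = true , true , r

    g : Pos (u ⊕ (v ⊕ w)) → Pos ((u ⊕ v) ⊕ w)
    g (false , p)         = false , false , p
    g (true  , false , q) = false , true , q
    g (true  , true  , r) = true , r

    g∘f : ∀ x → g (f x) ≡ x
    g∘f (false , false , _) = refl
    g∘f (false , true  , _) = refl
    g∘f (true  , _)         = refl

    f∘g : ∀ x → f (g x) ≡ x
    f∘g (false , _)         = refl
    f∘g (true  , false , _) = refl
    f∘g (true  , true  , _) = refl

    f-mono : ∀ {x y} → _<_ ((u ⊕ v) ⊕ w) x y → _<_ (u ⊕ (v ⊕ w)) (f x) (f y)
    f-mono {false , false , _} (inj₁ f<t)                         = inj₁ f<t
    f-mono {false , true  , _} (inj₁ f<t)                         = inj₂ (refl , inj₁ f<t)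
    f-mono {false , _}         (inj₂ (refl , inj₁ f<t))           = inj₁ f<t
    f-mono {false , false , _} (inj₂ (refl , inj₂ (refl , p<q)))  = inj₂ (refl , p<q)
    f-mono {false , true  , _} (inj₂ (refl , inj₂ (refl , p<q)))  = inj₂ (refl , inj₂ (refl , p<q))
    f-mono {true , _}          (inj₂ (refl , p<q))                = inj₂ (refl , inj₂ (refl , p<q))

    f-letter : ∀ x → letter (u ⊕ (v ⊕ w)) (f x) ≡ letter ((u ⊕ v) ⊕ w) x
    f-letter (false , false , _) = refl
    f-letter (false , true  , _) = refl
    f-letter (true  , _)         = refl

  ⊕-assoc : (u ⊕ v) ⊕ w ≅ u ⊕ (v ⊕ w)
  ⊕-assoc = mk≅ f g g∘f f∘g f-mono f-letter

⊕-identityˡ : (v : Word A) → emptyW ⊕ v ≅ v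
⊕-identityˡ v = ≅-sym (mk≅ (true ,_) (λ { (true , q) → q }) (λ _ → refl) (λ { (true , _) → refl })
                           (λ q<q′ → inj₂ (refl , q<q′)) (λ _ → refl))

⊕-identityʳ : (u : Word A) → u ⊕ emptyW ≅ u
⊕-identityʳ u = ≅-sym (mk≅ (false ,_) (λ { (false , p) → p }) (λ _ → refl) (λ { (false , _) → refl })
                            (λ p<p′ → inj₂ (refl , p<p′)) (λ _ → refl))

cat-++ : (xs ys : List (Word A)) → cat (xs ++ ys) ≅ cat xs ⊕ cat ys
cat-++ []       ys = ≅-sym (⊕-identityˡ (cat ys))
cat-++ (x ∷ xs) ys = ≅-trans (⊕-cong ≅-refl (cat-++ xs ys)) (≅-sym (⊕-assoc x (cat xs) (cat ys)))

cat-∷ʳ : (xs : List (Word A)) (x : Word A) → cat (xs ++ x ∷ []) ≅ cat xs ⊕ x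
cat-∷ʳ xs x = ≅-trans (cat-++ xs (x ∷ [])) (⊕-cong ≅-refl (⊕-identityʳ x))

digits-< : ∀ {n q q′} (r r′ : Fin n) → q <ℕ q′ → toℕ r + q * n <ℕ toℕ r′ + q′ * n
digits-< {n} {q} {q′} r r′ q<q′ = begin-strict
  toℕ r + q * n    <⟨ +-monoˡ-< (q * n) (toℕ<n r) ⟩
  suc q * n        ≤⟨ *-monoˡ-≤ n q<q′ ⟩
  q′ * n           ≤⟨ m≤n+m (q′ * n) (toℕ r′) ⟩
  toℕ r′ + q′ * n  ∎
  where open ≤-Reasoning

quotient-remainder-unique : ∀ {n q q′} (r r′ : Fin n) →
                            toℕ r + q * n ≡ toℕ r′ + q′ * n → q ≡ q′ × r ≡ r′
quotient-remainder-unique {n} {q} {q′} r r′ e with <-cmp q q′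
... | tri< q<q′ _ _ = ⊥-elim (<⇒≢ (digits-< r r′ q<q′) e)
... | tri≈ _ refl _ = refl , toℕ-injective (+-cancelʳ-≡ (q * n) (toℕ r) (toℕ r′) e)
... | tri> _ _ q′<q = ⊥-elim (<⇒≢ (digits-< r′ r q′<q) (sym e))

module _ (z : Word A) where
  ω-unfold : z ⊕ ω-power z ≅ ω-power z
  ω-unfold = mk≅ f g g∘f f∘g f-mono f-letter
    where
    f : Pos (z ⊕ ω-power z) → Pos (ω-power z)
    f (false , p)     = 0 , p
    f (true , k , p)  = suc k , p
    g : Pos (ω-power z) → Pos (z ⊕ ω-power z)
    g (zero , p)  = false , p
    g (suc k , p) = true , k , p
    g∘f : ∀ x → g (f x) ≡ x
    g∘f (false , _)    = refl
    g∘f (true , _ , _) = refl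
    f∘g : ∀ x → f (g x) ≡ x
    f∘g (zero , _)  = refl
    f∘g (suc _ , _) = refl
    f-mono : ∀ {x y} → _<_ (z ⊕ ω-power z) x y → _<_ (ω-power z) (f x) (f y)
    f-mono (inj₁ f<t)                                   = inj₁ z<s
    f-mono {false , _} (inj₂ (refl , p<q))              = inj₂ (refl , p<q)
    f-mono {true , _}  (inj₂ (refl , inj₁ k<k′))        = inj₁ (s≤s k<k′)
    f-mono {true , _}  (inj₂ (refl , inj₂ (refl , p<q))) = inj₂ (refl , p<q)
    f-letter : ∀ x → letter (ω-power z) (f x) ≡ letter (z ⊕ ω-power z) x
    f-letter (false , _)    = refl
    f-letter (true , _ , _) = refl

  power : ℕ → Word A
  power n = cat (replicate n z)

  power-⊕-ω : ∀ n → power n ⊕ ω-power z ≅ ω-power z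
  power-⊕-ω zero    = ⊕-identityˡ (ω-power z)
  power-⊕-ω (suc n) =
    ≅-trans (⊕-assoc z (power n) (ω-power z)) (≅-trans (⊕-cong ≅-refl (power-⊕-ω n)) ω-unfold)

  block : ∀ {n} → Fin n → Pos z → Pos (power n)
  block zero    p = false , p
  block (suc i) p = true , block i p

  unblock : ∀ n → Pos (power n) → Fin n × Pos z
  unblock (suc n) (false , p) = zero , p
  unblock (suc n) (true , x)  = map₁ suc (unblock n x)

  unblock-block : ∀ {n} (i : Fin n) p → unblock n (block i p) ≡ (i , p)
  unblock-block zero    p = refl
  unblock-block (suc i) p = cong (map₁ suc) (unblock-block i p)

  block-unblock : ∀ n (x : Pos (power n)) → uncurry block (unblock n x) ≡ x
  block-unblock (suc n) (false , p) = refl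
  block-unblock (suc n) (true , x)  = cong (true ,_) (block-unblock n x)

  unblock-letter : ∀ n (x : Pos (power n)) → letter z (proj₂ (unblock n x)) ≡ letter (power n) x
  unblock-letter (suc n) (false , p) = refl
  unblock-letter (suc n) (true , x)  = unblock-letter n x

  unblock-mono : ∀ n {x y : Pos (power n)} → _<_ (power n) x y →
                 let (i , p) = unblock n x ; (j , q) = unblock n y in
                 (toℕ i <ℕ toℕ j) ⊎ Σ (i ≡ j) (λ _ → _<_ z p q)
  unblock-mono (suc n) (inj₁ f<t) = inj₁ z<s
  unblock-mono (suc n) {false , _} (inj₂ (refl , p<q)) = inj₂ (refl , p<q)
  unblock-mono (suc n) {true , _}  (inj₂ (refl , x<y)) with unblock-mono n x<y
  ... | inj₁ i<j         = inj₁ (s≤s i<j)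
  ... | inj₂ (i≡j , p<q) = inj₂ (cong suc i≡j , p<q)

  -- Copy i of z in the k-th copy of zⁿ becomes copy i + k n of z; the inverse is division by n.
  ω-regroup : ∀ n .{{_ : NonZero n}} → ω-power (power n) ≅ ω-power z
  ω-regroup n = mk≅ f g g∘f f∘g f-mono f-letter
    where
    f : Pos (ω-power (power n)) → Pos (ω-power z)
    f (k , x) = toℕ (proj₁ (unblock n x)) + k * n , proj₂ (unblock n x)
    fromDivMod : ∀ {N} → DivMod N n → Pos z → Pos (ω-power (power n))
    fromDivMod (result q r _) p = q , block r p
    g : Pos (ω-power z) → Pos (ω-power (power n))
    g (N , p) = fromDivMod (N divMod n) p
    fromDivMod-digits : ∀ {k i p} (d : DivMod (toℕ i + k * n) n) → fromDivMod d p ≡ (k , block i p)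
    fromDivMod-digits {k} {i} (result q r e) with quotient-remainder-unique {q = q} {q′ = k} r i (sym e)
    ... | refl , refl = refl
    g∘f : ∀ x → g (f x) ≡ x
    g∘f (k , x) = ≡-trans (fromDivMod-digits (_ divMod n)) (cong (k ,_) (block-unblock n x))
    f∘fromDivMod : ∀ {N} (d : DivMod N n) p → f (fromDivMod d p) ≡ (N , p)
    f∘fromDivMod (result q r e) p =
      ≡-trans (cong (λ (i , p′) → toℕ i + q * n , p′) (unblock-block r p)) (cong (_, p) (sym e))
    f∘g : ∀ x → f (g x) ≡ x
    f∘g (N , p) = f∘fromDivMod (N divMod n) p
    f-mono : ∀ {x y} → _<_ (ω-power (power n)) x y → _<_ (ω-power z) (f x) (f y)
    f-mono {_ , x} {_ , y} (inj₁ k<k′) = inj₁ (digits-< (proj₁ (unblock n x)) (proj₁ (unblock n y)) k<k′)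
    f-mono {k , x} {_ , y} (inj₂ (refl , x<y)) with unblock n x | unblock n y | unblock-mono n x<y
    ... | _ , _ | _ , _ | inj₁ i<j          = inj₁ (+-monoˡ-< (k * n) i<j)
    ... | _ , _ | _ , _ | inj₂ (refl , p<q) = inj₂ (refl , p<q)
    f-letter : ∀ x → letter (ω-power z) (f x) ≡ letter (ω-power (power n)) x
    f-letter (_ , x) = unblock-letter n x

-- Evaluation in an ordinal monoid

module Evaluation (M : OrdinalMonoid) where
  open OrdinalMonoid M

  ≅⇒isConcat-oneW : {u v : Word Carrier} → u ≅ v → IsConcat (oneW u) v
  ≅⇒isConcat-oneW {u} {v} α = (λ p → tt , from α p) , injective , surjective , order , letters
    where
    injective : ∀ p q → (tt , from α p) ≡ (tt , from α q) → p ≡ q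
    injective p q e = ≡-trans (sym (to∘from α p)) (≡-trans (cong (to α ∘ proj₂) e) (to∘from α q))
    surjective : ∀ y → Σ (Pos v) (λ p → (tt , from α p) ≡ y)
    surjective (tt , x) = to α x , cong (tt ,_) (from∘to α x)
    order : ∀ p q → (_<_ v p q → Lex (oneW u) (tt , from α p) (tt , from α q))
                  × (Lex (oneW u) (tt , from α p) (tt , from α q) → _<_ v p q)
    order p q = (λ p<q → inj₂ (refl , from-mono α p<q))
              , λ { (inj₂ (refl , p<q)) → subst₂ (_<_ v) (to∘from α p) (to∘from α q) (to-mono α p<q) }
    letters : ∀ p → letter v p ≡ letter u (from α p)
    letters p = ≡-trans (cong (letter v) (sym (to∘from α p))) (to-letter α (from α p))

  -- By generalised associativity, π u and π v both equal the product of the one-letter word of words (u).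
  π-cong : {u v : Word Carrier} → u ≅ v → π u ≡ π v
  π-cong {u} {v} α = ≡-trans (sym (π-assoc (oneW u) u (≅⇒isConcat-oneW {u} ≅-refl)))
                             (π-assoc (oneW u) v (≅⇒isConcat-oneW {u} α))

  module _ (μ : A → Carrier) where
    eval : Word A → Carrier
    eval u = π (mapW μ u)

    eval-cong : {u v : Word A} → u ≅ v → eval u ≡ eval v
    eval-cong α = π-cong (≅-mapW μ α)

    eval-Concat : (w : Word (Word A)) → eval (Concat w) ≡ π (mapW eval w)
    eval-Concat w = sym (π-assoc (mapW (mapW μ) w) (mapW μ (Concat w)) (Concat-isConcat (mapW (mapW μ) w)))

    eval-ε : eval emptyW ≡ 𝟙
    eval-ε = π-cong (mk≅ (λ ()) (λ ()) (λ ()) (λ ()) (λ {}) (λ ()))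

    eval-oneW : (x : A) → eval (oneW x) ≡ μ x
    eval-oneW x = ≡-trans (π-cong (mk≅ id id (λ _ → refl) (λ _ → refl) id (λ _ → refl))) (π-one (μ x))

    eval-⊕ : (u v : Word A) → eval (u ⊕ v) ≡ eval u · eval v
    eval-⊕ u v = ≡-trans (eval-Concat _) (π-cong (mk≅ id id (λ _ → refl) (λ _ → refl) id pick-letter))
      where
      pick-letter : ∀ b → letter (twoW (eval u) (eval v)) b ≡ eval (pick u v b)
      pick-letter false = refl
      pick-letter true  = refl

    eval-ω : (u : Word A) → eval (ω-power u) ≡ eval u ^ω
    eval-ω u = ≡-trans (eval-Concat _) (π-cong (mk≅ id id (λ _ → refl) (λ _ → refl) id (λ _ → refl)))

    eval-cat-∷ʳ : (xs : List (Word A)) (x : Word A) → eval (cat (xs ++ x ∷ [])) ≡ eval (cat xs) · eval x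
    eval-cat-∷ʳ xs x = ≡-trans (eval-cong (cat-∷ʳ xs x)) (eval-⊕ (cat xs) x)

-- Ehrenfeucht–Fraïssé games

infixr 5 _◃_
_◃_ : {I P : Set} → P → (I → P) → Maybe I → P
(p ◃ ρ) nothing  = p
(p ◃ ρ) (just i) = ρ i

SameOrder : (u v : Word A) → Pos u → Pos u → Pos v → Pos v → Set
SameOrder u v x y x′ y′ = (_<_ u x y → _<_ v x′ y′) × (_<_ v x′ y′ → _<_ u x y)

SameOrder-subst : {u v : Word A} {x y x₀ y₀ : Pos u} {x′ y′ x₀′ y₀′ : Pos v} →
                  x ≡ x₀ → y ≡ y₀ → x′ ≡ x₀′ → y′ ≡ y₀′ → SameOrder u v x₀ y₀ x₀′ y₀′ → SameOrder u v x y x′ y′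
SameOrder-subst refl refl refl refl o = o

record PartialIso (u v : Word A) {I : Set} (ρ : I → Pos u) (σ : I → Pos v) : Set where
  constructor partialIso
  field
    order  : ∀ i j → SameOrder u v (ρ i) (ρ j) (σ i) (σ j)
    labels : ∀ i → letter u (ρ i) ≡ letter v (σ i)

open PartialIso public

data EF {A : Set} : ℕ → (u v : Word A) {I : Set} → (I → Pos u) → (I → Pos v) → Set₁ where
  last  : ∀ {u v I} {ρ : I → Pos u} {σ : I → Pos v} →
          PartialIso u v ρ σ → EF zero u v ρ σ
  round : ∀ {r u v I} {ρ : I → Pos u} {σ : I → Pos v} → PartialIso u v ρ σ →
          (∀ p → Σ (Pos v) λ q → EF r u v (p ◃ ρ) (q ◃ σ)) →
          (∀ q → Σ (Pos u) λ p → EF r u v (p ◃ ρ) (q ◃ σ)) →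
          EF (suc r) u v ρ σ

infix 4 _∼[_]_
_∼[_]_ : Word A → ℕ → Word A → Set₁
u ∼[ r ] v = EF r u v {⊥} ⊥-elim ⊥-elim

module _ {u v : Word A} {I : Set} {ρ : I → Pos u} {σ : I → Pos v} where
  EF-partialIso : ∀ {r} → EF r u v ρ σ → PartialIso u v ρ σ
  EF-partialIso (last P)      = P
  EF-partialIso (round P _ _) = P

  EF-forth : ∀ {r} → EF (suc r) u v ρ σ → ∀ p → Σ (Pos v) λ q → EF r u v (p ◃ ρ) (q ◃ σ)
  EF-forth (round _ forth _) = forth

EF-weaken : ∀ {r} {u v : Word A} {I} {ρ : I → Pos u} {σ : I → Pos v} → EF (suc r) u v ρ σ → EF r u v ρ σ
EF-weaken {r = zero}  (round P _ _)        = last P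
EF-weaken {r = suc r} (round P forth back) = round P (map₂ EF-weaken ∘ forth) (map₂ EF-weaken ∘ back)

partialIso-∅ : {u v : Word A} → PartialIso u v {⊥} ⊥-elim ⊥-elim
partialIso-∅ = partialIso (λ ()) (λ ())

module _ {u v u′ v′ : Word A} (α : u ≅ u′) (β : v ≅ v′) where
  PartialIso-along : ∀ {I J} {ρ : I → Pos u} {σ : I → Pos v} {ρ′ : J → Pos u′} {σ′ : J → Pos v′}
                     (h : J → I) → ρ′ ≗ to α ∘ ρ ∘ h → σ′ ≗ to β ∘ σ ∘ h →
                     PartialIso u v ρ σ → PartialIso u′ v′ ρ′ σ′
  PartialIso-along {ρ = ρ} {σ} {ρ′} {σ′} h eρ eσ P = partialIso order′ labels′
    where
    order′ : ∀ i j → SameOrder u′ v′ (ρ′ i) (ρ′ j) (σ′ i) (σ′ j)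
    order′ i j = (σ→ ∘ proj₁ (order P (h i) (h j)) ∘ ρ←) , (ρ→ ∘ proj₂ (order P (h i) (h j)) ∘ σ←)
      where
      ρ← : _<_ u′ (ρ′ i) (ρ′ j) → _<_ u (ρ (h i)) (ρ (h j))
      ρ← = to-reflect α ∘ subst₂ (_<_ u′) (eρ i) (eρ j)
      ρ→ : _<_ u (ρ (h i)) (ρ (h j)) → _<_ u′ (ρ′ i) (ρ′ j)
      ρ→ = subst₂ (_<_ u′) (sym (eρ i)) (sym (eρ j)) ∘ to-mono α
      σ← : _<_ v′ (σ′ i) (σ′ j) → _<_ v (σ (h i)) (σ (h j))
      σ← = to-reflect β ∘ subst₂ (_<_ v′) (eσ i) (eσ j)
      σ→ : _<_ v (σ (h i)) (σ (h j)) → _<_ v′ (σ′ i) (σ′ j)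
      σ→ = subst₂ (_<_ v′) (sym (eσ i)) (sym (eσ j)) ∘ to-mono β
    labels′ : ∀ i → letter u′ (ρ′ i) ≡ letter v′ (σ′ i)
    labels′ i = begin
      letter u′ (ρ′ i)            ≡⟨ cong (letter u′) (eρ i) ⟩
      letter u′ (to α (ρ (h i)))  ≡⟨ to-letter α (ρ (h i)) ⟩
      letter u (ρ (h i))          ≡⟨ labels P (h i) ⟩
      letter v (σ (h i))          ≡⟨ to-letter β (σ (h i)) ⟨
      letter v′ (to β (σ (h i)))  ≡⟨ cong (letter v′) (eσ i) ⟨
      letter v′ (σ′ i)            ∎
      where open ≡-Reasoning

  EF-along : ∀ {r I J} {ρ : I → Pos u} {σ : I → Pos v} {ρ′ : J → Pos u′} {σ′ : J → Pos v′}
             (h : J → I) → ρ′ ≗ to α ∘ ρ ∘ h → σ′ ≗ to β ∘ σ ∘ h →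
             EF r u v ρ σ → EF r u′ v′ ρ′ σ′
  EF-along h eρ eσ (last P) = last (PartialIso-along h eρ eσ P)
  EF-along {suc r} {ρ = ρ} {σ} {ρ′} {σ′} h eρ eσ (round P forth back) =
    round (PartialIso-along h eρ eσ P) forth′ back′
    where
    forth′ : ∀ p′ → Σ (Pos v′) λ q′ → EF r u′ v′ (p′ ◃ ρ′) (q′ ◃ σ′)
    forth′ p′ with forth (from α p′)
    ... | q , g = to β q , EF-along (mapᴹ h) (λ { nothing → sym (to∘from α p′) ; (just j) → eρ j })
                                              (λ { nothing → refl ; (just j) → eσ j }) g
    back′ : ∀ q′ → Σ (Pos u′) λ p′ → EF r u′ v′ (p′ ◃ ρ′) (q′ ◃ σ′)
    back′ q′ with back (from β q′)
    ... | p , g = to α p , EF-along (mapᴹ h) (λ { nothing → refl ; (just j) → eρ j })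
                                             (λ { nothing → sym (to∘from β q′) ; (just j) → eσ j }) g

EF-reindex : ∀ {r} {u v : Word A} {I J} {ρ : I → Pos u} {σ : I → Pos v} {ρ′ : J → Pos u} {σ′ : J → Pos v}
             (h : J → I) → ρ′ ≗ ρ ∘ h → σ′ ≗ σ ∘ h → EF r u v ρ σ → EF r u v ρ′ σ′
EF-reindex = EF-along ≅-refl ≅-refl

∼-transport : ∀ {r} {u v u′ v′ : Word A} → u ≅ u′ → v ≅ v′ → u ∼[ r ] v → u′ ∼[ r ] v′
∼-transport α β = EF-along α β id (λ ()) (λ ())

EF-refl : ∀ r (u : Word A) {I} (ρ : I → Pos u) → EF r u u ρ ρ
EF-refl zero    u ρ = last (partialIso (λ _ _ → id , id) (λ _ → refl))
EF-refl (suc r) u ρ = round (partialIso (λ _ _ → id , id) (λ _ → refl))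
                            (λ p → p , EF-refl r u (p ◃ ρ)) (λ p → p , EF-refl r u (p ◃ ρ))

PartialIso-sym : {u v : Word A} {I : Set} {ρ : I → Pos u} {σ : I → Pos v} →
                 PartialIso u v ρ σ → PartialIso v u σ ρ
PartialIso-sym P = partialIso (λ i j → swap (order P i j)) (sym ∘ labels P)

EF-sym : ∀ {r} {u v : Word A} {I} {ρ : I → Pos u} {σ : I → Pos v} → EF r u v ρ σ → EF r v u σ ρ
EF-sym (last P)             = last (PartialIso-sym P)
EF-sym (round P forth back) = round (PartialIso-sym P) (map₂ EF-sym ∘ back) (map₂ EF-sym ∘ forth)

PartialIso-trans : {u v w : Word A} {I : Set} {ρ : I → Pos u} {σ : I → Pos v} {τ : I → Pos w} →
                   PartialIso u v ρ σ → PartialIso v w σ τ → PartialIso u w ρ τ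
PartialIso-trans P Q = partialIso
  (λ i j → proj₁ (order Q i j) ∘ proj₁ (order P i j) , proj₂ (order P i j) ∘ proj₂ (order Q i j))
  (λ i → ≡-trans (labels P i) (labels Q i))

EF-trans : ∀ {r} {u v w : Word A} {I} {ρ : I → Pos u} {σ : I → Pos v} {τ : I → Pos w} →
           EF r u v ρ σ → EF r v w σ τ → EF r u w ρ τ
EF-trans (last P) (last Q) = last (PartialIso-trans P Q)
EF-trans (round P forth back) (round Q forth′ back′) = round (PartialIso-trans P Q)
  (λ p → let q , g = forth p ; s , g′ = forth′ q in s , EF-trans g g′)
  (λ s → let q , g′ = back′ s ; p , g = back q in p , EF-trans g g′)

∼-sym : ∀ {r} {u v : Word A} → u ∼[ r ] v → v ∼[ r ] u
∼-sym = EF-reindex id (λ ()) (λ ()) ∘ EF-sym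

rank : ∀ {n} → Formula A n → ℕ
rank (_ <ᶠ _)  = 0
rank (_ ≡ᶠ _)  = 0
rank (lab _ _) = 0
rank (¬ᶠ φ)    = rank φ
rank (φ ∧ᶠ ψ)  = rank φ ℕ.⊔ rank ψ
rank (∃ᶠ φ)    = suc (rank φ)

fin→maybe : ∀ {n} → Fin (suc n) → Maybe (Fin n)
fin→maybe zero    = nothing
fin→maybe (suc i) = just i

extend≗◃ : ∀ {P : Set} {n} (p : P) (ρ : Fin n → P) → extend p ρ ≗ (p ◃ ρ) ∘ fin→maybe
extend≗◃ p ρ zero    = refl
extend≗◃ p ρ (suc i) = refl

PartialIso-≡ : {u v : Word A} {I : Set} {ρ : I → Pos u} {σ : I → Pos v} →
               PartialIso u v ρ σ → ∀ i j → ρ i ≡ ρ j → σ i ≡ σ j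
PartialIso-≡ {u = u} {v} {ρ = ρ} {σ} P i j ρi≡ρj with compare v (σ i) (σ j)
... | tri≈ _ σi≡σj _ = σi≡σj
... | tri< σi<σj _ _ = ⊥-elim (<-irreflexive u (subst (λ x → _<_ u x (ρ j)) ρi≡ρj (proj₂ (order P i j) σi<σj)))
... | tri> _ _ σj<σi = ⊥-elim (<-irreflexive u (subst (_<_ u (ρ j)) ρi≡ρj (proj₂ (order P j i) σj<σi)))

EF-sound : ∀ {n} (φ : Formula A n) {r} → rank φ ≤ r →
           ∀ {u v} {ρ : Fin n → Pos u} {σ : Fin n → Pos v} → EF r u v ρ σ →
           (Sat⟨ u ⊨ φ [ ρ ]⟩ → Sat⟨ v ⊨ φ [ σ ]⟩) × (Sat⟨ v ⊨ φ [ σ ]⟩ → Sat⟨ u ⊨ φ [ ρ ]⟩)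
EF-sound (i <ᶠ j)  _ g = order (EF-partialIso g) i j
EF-sound (i ≡ᶠ j)  _ g =
  PartialIso-≡ (EF-partialIso g) i j , PartialIso-≡ (PartialIso-sym (EF-partialIso g)) i j
EF-sound (lab x i) _ g = ≡-trans (sym (labels (EF-partialIso g) i)) , ≡-trans (labels (EF-partialIso g) i)
EF-sound (¬ᶠ φ) φ≤r g = let φ→ , φ← = EF-sound φ φ≤r g in (_∘ φ←) , (_∘ φ→)
EF-sound (φ ∧ᶠ ψ) φψ≤r g =
  let φ→ , φ← = EF-sound φ (≤-trans (m≤m⊔n (rank φ) (rank ψ)) φψ≤r) g
      ψ→ , ψ← = EF-sound ψ (≤-trans (m≤n⊔m (rank φ) (rank ψ)) φψ≤r) g
  in map φ→ ψ→ , map φ← ψ←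
EF-sound (∃ᶠ φ) (s≤s φ≤r) {u} {v} {ρ} {σ} (round _ forth back) =
    (λ (p , sat) → let q , g = forth p in q , proj₁ (EF-sound φ φ≤r (restrict p q g)) sat)
  , (λ (q , sat) → let p , g = back q in p , proj₂ (EF-sound φ φ≤r (restrict p q g)) sat)
  where
  restrict : ∀ {r} p q → EF r u v (p ◃ ρ) (q ◃ σ) → EF r u v (extend p ρ) (extend q σ)
  restrict p q = EF-reindex fin→maybe (extend≗◃ p ρ) (extend≗◃ q σ)

∼-sound : {u v : Word A} (φ : Sentence A) → u ∼[ rank φ ] v → (u ⊨ φ → v ⊨ φ) × (v ⊨ φ → u ⊨ φ)
∼-sound φ g = EF-sound φ ≤-refl (EF-reindex (λ ()) (λ ()) (λ ()) g)

-- Games on concatenations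

Pos-≟ : (u : Word A) → DecidableEquality (Pos u)
Pos-≟ u x y with compare u x y
... | tri< _ x≢y _ = no x≢y
... | tri≈ _ x≡y _ = yes x≡y
... | tri> _ x≢y _ = no x≢y

module _ {B : Set} (J : Word B) (f f′ : Pos J → Word A) where
  private
    C C′ : Word A
    C  = ConcatOver J f
    C′ = ConcatOver J f′

  module _ {I : Set} (ρ : I → Pos C) (σ : I → Pos C′) where
    InBlockAt : Pos J → I → Set
    InBlockAt k i = Σ (Pos (f k)) λ p → Σ (Pos (f′ k)) λ q → ρ i ≡ (k , p) × σ i ≡ (k , q)

    InBlock : Pos J → Set
    InBlock k = Σ I (InBlockAt k)

    Aligned : Set
    Aligned = ∀ i → Σ (Pos J) λ k → InBlockAt k i

    restrictˡ : ∀ k → InBlock k → Pos (f k)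
    restrictˡ k (_ , p , _) = p

    restrictʳ : ∀ k → InBlock k → Pos (f′ k)
    restrictʳ k (_ , _ , q , _) = q

    BlockwiseEF : ℕ → Set₁
    BlockwiseEF r = ∀ k → EF r (f k) (f′ k) (restrictˡ k) (restrictʳ k)

  SameOrder-Lex : ∀ k l (p : Pos (f k)) (q : Pos (f′ k)) (p′ : Pos (f l)) (q′ : Pos (f′ l)) →
                  ((e : k ≡ l) → SameOrder (f l) (f′ l) (subst (Pos ∘ f) e p) p′ (subst (Pos ∘ f′) e q) q′) →
                  SameOrder C C′ (k , p) (l , p′) (k , q) (l , q′)
  SameOrder-Lex k l p q p′ q′ same = [ inj₁ , (λ (e , lt) → inj₂ (e , proj₁ (same e) lt)) ]
                                   , [ inj₁ , (λ (e , lt) → inj₂ (e , proj₂ (same e) lt)) ]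

  PartialIso-Concat : ∀ {I} {ρ : I → Pos C} {σ : I → Pos C′} → Aligned ρ σ →
                      (∀ k → PartialIso (f k) (f′ k) (restrictˡ ρ σ k) (restrictʳ ρ σ k)) → PartialIso C C′ ρ σ
  PartialIso-Concat {ρ = ρ} {σ} aligned P = partialIso order′ labels′
    where
    order′ : ∀ i j → SameOrder C C′ (ρ i) (ρ j) (σ i) (σ j)
    order′ i j with aligned i | aligned j
    ... | k , p , q , e₁ , e₂ | l , p′ , q′ , e₃ , e₄ =
      SameOrder-subst {u = C} {v = C′} e₁ e₃ e₂ e₄ (SameOrder-Lex k l p q p′ q′ same)
      where
      same : (e : k ≡ l) → SameOrder (f l) (f′ l) (subst (Pos ∘ f) e p) p′ (subst (Pos ∘ f′) e q) q′
      same refl = order (P k) (i , p , q , e₁ , e₂) (j , p′ , q′ , e₃ , e₄)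
    labels′ : ∀ i → letter C (ρ i) ≡ letter C′ (σ i)
    labels′ i with aligned i
    ... | k , p , q , e₁ , e₂ =
      ≡-trans (cong (letter C) e₁) (≡-trans (labels (P k) (i , p , q , e₁ , e₂)) (sym (cong (letter C′) e₂)))

module _ {B : Set} (J : Word B) (f f′ : Pos J → Word A) {I : Set}
         {ρ : I → Pos (ConcatOver J f)} {σ : I → Pos (ConcatOver J f′)} where
  Aligned-swap : Aligned J f f′ ρ σ → Aligned J f′ f σ ρ
  Aligned-swap aligned i = let k , p , q , e₁ , e₂ = aligned i in k , q , p , e₂ , e₁

  BlockwiseEF-swap : ∀ {r} → BlockwiseEF J f f′ ρ σ r → BlockwiseEF J f′ f σ ρ r
  BlockwiseEF-swap H k =
    EF-reindex (λ (i , q , p , e₂ , e₁) → i , p , q , e₁ , e₂) (λ _ → refl) (λ _ → refl) (EF-sym (H k))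

mutual
  EF-Concat : ∀ {B : Set} (J : Word B) (f f′ : Pos J → Word A) r {I}
              {ρ : I → Pos (ConcatOver J f)} {σ : I → Pos (ConcatOver J f′)} →
              Aligned J f f′ ρ σ → BlockwiseEF J f f′ ρ σ r → EF r (ConcatOver J f) (ConcatOver J f′) ρ σ
  EF-Concat J f f′ zero aligned H = last (PartialIso-Concat J f f′ aligned (EF-partialIso ∘ H))
  EF-Concat J f f′ (suc r) aligned H = round (PartialIso-Concat J f f′ aligned (EF-partialIso ∘ H))
    (EF-Concat-forth J f f′ r aligned H)
    (map₂ EF-sym ∘ EF-Concat-forth J f′ f r (Aligned-swap J f f′ aligned) (BlockwiseEF-swap J f f′ H))

  -- A move in block k is answered inside block k by the block game; every other block just drops a round.
  EF-Concat-forth : ∀ {B : Set} (J : Word B) (f f′ : Pos J → Word A) r {I}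
                    {ρ : I → Pos (ConcatOver J f)} {σ : I → Pos (ConcatOver J f′)} →
                    Aligned J f f′ ρ σ → BlockwiseEF J f f′ ρ σ (suc r) →
                    ∀ x → Σ (Pos (ConcatOver J f′)) λ y →
                          EF r (ConcatOver J f) (ConcatOver J f′) (x ◃ ρ) (y ◃ σ)
  EF-Concat-forth J f f′ r {I} {ρ} {σ} aligned H (k , p) = (k , q) , EF-Concat J f f′ r aligned′ H′
    where
    q : Pos (f′ k)
    q = proj₁ (EF-forth (H k) p)
    ρ′ : Maybe I → Pos (ConcatOver J f)
    ρ′ = (k , p) ◃ ρ
    σ′ : Maybe I → Pos (ConcatOver J f′)
    σ′ = (k , q) ◃ σ
    aligned′ : Aligned J f f′ ρ′ σ′
    aligned′ nothing  = k , p , q , refl , refl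
    aligned′ (just i) = aligned i
    H′ : BlockwiseEF J f f′ ρ′ σ′ r
    H′ l with Pos-≟ J l k
    ... | yes refl = EF-reindex new eˡ eʳ (proj₂ (EF-forth (H k) p))
      where
      new : InBlock J f f′ ρ′ σ′ k → Maybe (InBlock J f f′ ρ σ k)
      new (nothing , _) = nothing
      new (just i , x)  = just (i , x)
      eˡ : ∀ x → restrictˡ J f f′ ρ′ σ′ k x ≡ (p ◃ restrictˡ J f f′ ρ σ k) (new x)
      eˡ (nothing , _ , _ , refl , _) = refl
      eˡ (just _ , _)                 = refl
      eʳ : ∀ x → restrictʳ J f f′ ρ′ σ′ k x ≡ (q ◃ restrictʳ J f f′ ρ σ k) (new x)
      eʳ (nothing , _ , _ , _ , refl) = refl
      eʳ (just _ , _)                 = refl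
    ... | no l≢k = EF-reindex old eˡ eʳ (EF-weaken (H l))
      where
      old : InBlock J f f′ ρ′ σ′ l → InBlock J f f′ ρ σ l
      old (nothing , _ , _ , e , _) = ⊥-elim (l≢k (cong proj₁ (sym e)))
      old (just i , x)              = i , x
      eˡ : ∀ x → restrictˡ J f f′ ρ′ σ′ l x ≡ restrictˡ J f f′ ρ σ l (old x)
      eˡ (nothing , _ , _ , e , _) = ⊥-elim (l≢k (cong proj₁ (sym e)))
      eˡ (just _ , _)              = refl
      eʳ : ∀ x → restrictʳ J f f′ ρ′ σ′ l x ≡ restrictʳ J f f′ ρ σ l (old x)
      eʳ (nothing , _ , _ , e , _) = ⊥-elim (l≢k (cong proj₁ (sym e)))
      eʳ (just _ , _)              = refl

EF-ConcatOver : ∀ {B : Set} (J : Word B) (f f′ : Pos J → Word A) {r} {I : Pos J → Set}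
                {ρ : ∀ k → I k → Pos (f k)} {σ : ∀ k → I k → Pos (f′ k)} →
                (∀ k → EF r (f k) (f′ k) (ρ k) (σ k)) →
                EF r (ConcatOver J f) (ConcatOver J f′) (λ (k , i) → k , ρ k i) (λ (k , i) → k , σ k i)
EF-ConcatOver J f f′ {r} {I} {ρ} {σ} G = EF-Concat J f f′ r aligned H
  where
  ρ̂ : Σ (Pos J) I → Pos (ConcatOver J f)
  ρ̂ (k , i) = k , ρ k i
  σ̂ : Σ (Pos J) I → Pos (ConcatOver J f′)
  σ̂ (k , i) = k , σ k i
  aligned : Aligned J f f′ ρ̂ σ̂
  aligned (k , i) = k , ρ k i , σ k i , refl , refl
  H : BlockwiseEF J f f′ ρ̂ σ̂ r
  H k = EF-reindex index eˡ eʳ (G k)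
    where
    index : InBlock J f f′ ρ̂ σ̂ k → I k
    index ((_ , i) , _ , _ , refl , refl) = i
    eˡ : ∀ x → restrictˡ J f f′ ρ̂ σ̂ k x ≡ ρ k (index x)
    eˡ ((_ , _) , _ , _ , refl , refl) = refl
    eʳ : ∀ x → restrictʳ J f f′ ρ̂ σ̂ k x ≡ σ k (index x)
    eʳ ((_ , _) , _ , _ , refl , refl) = refl

EF-⊕ : ∀ {r} {u u′ v v′ : Word A} {I₁ I₂ : Set}
       {ρ₁ : I₁ → Pos u} {σ₁ : I₁ → Pos u′} {ρ₂ : I₂ → Pos v} {σ₂ : I₂ → Pos v′} →
       EF r u u′ ρ₁ σ₁ → EF r v v′ ρ₂ σ₂ →
       EF r (u ⊕ v) (u′ ⊕ v′) [ (false ,_) ∘ ρ₁ , (true ,_) ∘ ρ₂ ] [ (false ,_) ∘ σ₁ , (true ,_) ∘ σ₂ ]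
EF-⊕ {r = r} {u = u} {u′} {v} {v′} {I₁} {I₂} {ρ₁} {σ₁} {ρ₂} {σ₂} G₁ G₂ =
  EF-reindex tag [ (λ _ → refl) , (λ _ → refl) ] [ (λ _ → refl) , (λ _ → refl) ]
             (EF-ConcatOver (twoW tt tt) (pick u v) (pick u′ v′) {I = Index} {ρ} {σ} G)
  where
  Index : Bool → Set
  Index b = if b then I₂ else I₁
  tag : I₁ ⊎ I₂ → Σ Bool Index
  tag = [ (false ,_) , (true ,_) ]
  ρ : ∀ b → Index b → Pos (pick u v b)
  ρ false = ρ₁
  ρ true  = ρ₂
  σ : ∀ b → Index b → Pos (pick u′ v′ b)
  σ false = σ₁
  σ true  = σ₂
  G : ∀ b → EF r (pick u v b) (pick u′ v′ b) (ρ b) (σ b)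
  G false = G₁
  G true  = G₂

∼-⊕ : ∀ {r} {u u′ v v′ : Word A} → u ∼[ r ] u′ → v ∼[ r ] v′ → u ⊕ v ∼[ r ] u′ ⊕ v′
∼-⊕ G₁ G₂ = EF-reindex ⊥-elim (λ ()) (λ ()) (EF-⊕ G₁ G₂)

∼-ω-power : ∀ {r} {u u′ : Word A} → u ∼[ r ] u′ → ω-power u ∼[ r ] ω-power u′
∼-ω-power G = EF-reindex ⊥-elim (λ ()) (λ ()) (EF-ConcatOver (omegaW tt) _ _ {I = λ _ → ⊥} (λ _ → G))

-- Counting blocks

ThresholdEq : ℕ → ℕ → ℕ → Set
ThresholdEq t m n = m ≡ n ⊎ (t ≤ m × t ≤ n)

ThresholdEq-sym : ∀ {t m n} → ThresholdEq t m n → ThresholdEq t n m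
ThresholdEq-sym (inj₁ m≡n)        = inj₁ (sym m≡n)
ThresholdEq-sym (inj₂ (t≤m , t≤n)) = inj₂ (t≤n , t≤m)

-- threshold r = 2ʳ − 1
threshold : ℕ → ℕ
threshold zero    = zero
threshold (suc r) = suc (threshold r + threshold r)

complement : ∀ {t a L} → t + suc a ≤ L → Σ ℕ λ c → (c + suc a ≡ L) × (t ≤ c)
complement {t} {a} {L} t+a<L = L ∸ suc a , m∸n+n≡m (≤-trans (m≤n+m (suc a) t) t+a<L) , m+n≤o⇒m≤o∸n t t+a<L

short-side-fits : ∀ {t x L} → x <ℕ t → suc (t + t) ≤ L → t + suc x ≤ L
short-side-fits {t} x<t = ≤-trans (≤-trans (+-monoʳ-≤ t x<t) (n≤1+n (t + t)))

split-threshold : ∀ t a b L → ThresholdEq (suc (t + t)) (a + suc b) L →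
                  Σ ℕ λ a′ → Σ ℕ λ b′ → (a′ + suc b′ ≡ L) × ThresholdEq t a a′ × ThresholdEq t b b′
split-threshold t a b L (inj₁ e) = a , b , e , inj₁ refl , inj₁ refl
split-threshold t a b L (inj₂ (long , longL)) with a <? t | b <? t
... | yes a<t | _ = let c , e , t≤c = complement (short-side-fits a<t longL) in
  a , c , ≡-trans (+-comm a (suc c)) (≡-trans (sym (+-suc c a)) e) , inj₁ refl , inj₂ (t≤b , t≤c)
  where
  t≤b : t ≤ b
  t≤b = ≮⇒≥ λ b<t → <-asym (+-mono-≤ a<t b<t) long
... | no a≮t | yes b<t = let c , e , t≤c = complement (short-side-fits b<t longL) in
  c , b , e , inj₂ (≮⇒≥ a≮t , t≤c) , inj₁ refl
... | no a≮t | no b≮t = let c , e , t≤c = complement (≤-trans (≤-reflexive (+-suc t t)) longL) in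
  t , c , ≡-trans (+-comm t (suc c)) (≡-trans (sym (+-suc c t)) e)
    , inj₂ (≮⇒≥ a≮t , ≤-refl) , inj₂ (≮⇒≥ b≮t , t≤c)

record Located (xs : List (Word A)) (p : Pos (cat xs)) : Set₁ where
  field
    front rear : List (Word A)
    focus      : Word A
    offset     : Pos focus
    splits     : front ++ focus ∷ rear ≡ xs
    regroup    : cat xs ≅ cat front ⊕ (focus ⊕ cat rear)
    regroup-at : to regroup p ≡ (true , false , offset)

locate : (xs : List (Word A)) (p : Pos (cat xs)) → Located xs p
locate (x ∷ xs) (false , p) = record
  { front = [] ; rear = xs ; focus = x ; offset = p ; splits = refl
  ; regroup = ≅-sym (⊕-identityˡ (cat (x ∷ xs))) ; regroup-at = refl }
locate (x ∷ xs) (true , p) = record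
  { front = x ∷ front ; rear = rear ; focus = focus ; offset = offset ; splits = cong (x ∷_) splits
  ; regroup = ≅-trans (⊕-cong ≅-refl regroup) (≅-sym (⊕-assoc x (cat front) (focus ⊕ cat rear)))
  ; regroup-at = cong (λ y → from (⊕-assoc x (cat front) (focus ⊕ cat rear)) (true , y)) regroup-at }
  where open Located (locate xs p)

split-at-length : {C : Set a} (ys : List C) (m n : ℕ) → length ys ≡ m + suc n →
                  Σ (List C) λ as → Σ C λ y → Σ (List C) λ bs →
                  (as ++ y ∷ bs ≡ ys) × (length as ≡ m) × (length bs ≡ n)
split-at-length (y ∷ ys) zero    n e = [] , y , ys , refl , refl , suc-injective e
split-at-length (y ∷ ys) (suc m) n e =
  let as , z , bs , e₁ , e₂ , e₃ = split-at-length ys m n (suc-injective e) in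
  y ∷ as , z , bs , cong (y ∷_) e₁ , cong suc e₂ , e₃

module _ (P : Word A → Set₁) where
  Uniform : ℕ → Set₁
  Uniform r = ∀ {x y} → P x → P y → x ∼[ r ] y

  Uniform-sym : ∀ {r} → Uniform r → Uniform r
  Uniform-sym U Px Py = ∼-sym (U Py Px)

  mutual
    ∼-cat : ∀ r {xs ys} → Uniform r → All P xs → All P ys →
            ThresholdEq (threshold r) (length xs) (length ys) → cat xs ∼[ r ] cat ys
    ∼-cat zero    _ _ _ _ = last partialIso-∅
    ∼-cat (suc r) U Pxs Pys eq = round partialIso-∅ (cat-forth r U Pxs Pys eq)
      (map₂ EF-sym ∘ cat-forth r (Uniform-sym U) Pys Pxs (ThresholdEq-sym eq))

    -- Spoiler's position splits xs around one block; Duplicator answers in the block of ys chosen by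
    -- split-threshold, plays the block game there and the rank-r game on both sides of it.
    cat-forth : ∀ r {xs ys} → Uniform (suc r) → All P xs → All P ys →
                ThresholdEq (threshold (suc r)) (length xs) (length ys) →
                ∀ p → Σ (Pos (cat ys)) λ q → EF r (cat xs) (cat ys) (p ◃ ⊥-elim) (q ◃ ⊥-elim)
    cat-forth r {xs} {ys} U Pxs Pys eq p with locate xs p
    ... | record { front = front ; rear = rear ; focus = x ; offset = o ; splits = refl
                 ; regroup = α ; regroup-at = αp }
        with split-threshold (threshold r) (length front) (length rear) (length ys)
                             (subst (λ n → ThresholdEq _ n (length ys)) (length-++ front) eq)
    ... | a′ , b′ , e , eq-front , eq-rear with split-at-length ys a′ b′ (sym e)
    ... | as , y , bs , refl , refl , refl =
      from β (true , false , q) ,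
      EF-along (≅-sym α) (≅-sym β) (λ _ → inj₂ (inj₁ nothing)) (λ { nothing → p≡ }) (λ { nothing → refl })
        (EF-⊕ (∼-cat r U′ Pfront Pas eq-front) (EF-⊕ g (∼-cat r U′ Prear Pbs eq-rear)))
      where
      β : cat (as ++ y ∷ bs) ≅ cat as ⊕ cat (y ∷ bs)
      β = cat-++ as (y ∷ bs)
      U′ : Uniform r
      U′ Px Py = EF-weaken (U Px Py)
      Pfront : All P front
      Pfront = proj₁ (++⁻ front Pxs)
      Prear : All P rear
      Prear = All.tail (proj₂ (++⁻ front Pxs))
      Pas : All P as
      Pas = proj₁ (++⁻ as Pys)
      Pbs : All P bs
      Pbs = All.tail (proj₂ (++⁻ as Pys))
      answer : Σ (Pos y) λ q → EF r x y (o ◃ ⊥-elim) (q ◃ ⊥-elim)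
      answer = EF-forth (U (All.head (proj₂ (++⁻ front Pxs))) (All.head (proj₂ (++⁻ as Pys)))) o
      q : Pos y
      q = proj₁ answer
      g : EF r x y (o ◃ ⊥-elim) (q ◃ ⊥-elim)
      g = proj₂ answer
      p≡ : p ≡ from α (true , false , o)
      p≡ = sym (≡-trans (cong (from α) (sym αp)) (from∘to α p))

-- Words for the elements of Sat

n≤n! : ∀ n → n ≤ n !
n≤n! zero    = z≤n
n≤n! (suc n) = ≤-trans (≤-reflexive (sym (*-identityʳ (suc n)))) (*-monoʳ-≤ (suc n) (1≤n! n))

module SatWords (M : FiniteOrdinalMonoid) {Σ′ : Set} (μ : Σ′ → FiniteOrdinalMonoid.Carrier M) where
  open FiniteOrdinalMonoid M
  open Evaluation monoid

  ⟦_⟧ₛ : SatTerm M μ → Pred Carrier 0ℓ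
  ⟦_⟧ₛ = ⟦_⟧ M μ

  -- An exponent n! + k with n ≥ N witnessing X^merge, taken with n ≥ threshold r so that
  -- the corresponding power has at least threshold r factors.
  mergeExponent : ℕ → ℕ → ℕ → ℕ
  mergeExponent r k N = (N + threshold r) ! + k

  threshold≤mergeExponent : ∀ r k N → threshold r ≤ mergeExponent r k N
  threshold≤mergeExponent r k N = ≤-trans (m≤n+m (threshold r) N) (≤-trans (n≤n! (N + threshold r)) (m≤m+n _ k))

  atMergeExponent : ∀ {X : Pred Carrier 0ℓ} r k N {m} → (∀ n → N ≤ n → powP X (n ! + k) m) →
                    powP X (mergeExponent r k N) m
  atMergeExponent r k N pow = pow (N + threshold r) (m≤m+n N (threshold r))

  mutual
    word : (t : SatTerm M μ) → ℕ → ∀ {m} → ⟦ t ⟧ₛ m → Word Σ′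
    word unit     r _ = emptyW
    word (lett a) r _ = oneW a
    word (s ⊗ t)  r (_ , _ , ps , pt , _) = word s r ps ⊕ word t r pt
    word (omg t)  r (_ , _ , (n , pu) , (n′ , pv) , _) =
      cat (blocks t r (suc n) pu) ⊕ ω-power (cat (blocks t r (suc n′) pv))
    word (mrg t)  r (k , N , pow) = cat (blocks t r (mergeExponent r k N) (atMergeExponent r k N pow))

    blocks : (t : SatTerm M μ) → ℕ → ∀ j {m} → powP ⟦ t ⟧ₛ j m → List (Word Σ′)
    blocks t r zero                _                    = []
    blocks t r (suc zero)          pt                   = word t r pt ∷ []
    blocks t r (suc (suc j)) (_ , _ , pj , pt , _) = blocks t r (suc j) pj ++ word t r pt ∷ []

  mutual
    eval-word : ∀ t r {m} (pm : ⟦ t ⟧ₛ m) → eval μ (word t r pm) ≡ m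
    eval-word unit     r m≡𝟙 = ≡-trans (eval-ε μ) (sym m≡𝟙)
    eval-word (lett a) r m≡a = ≡-trans (eval-oneW μ a) (sym m≡a)
    eval-word (s ⊗ t)  r (_ , _ , ps , pt , e) = begin
      eval μ (word s r ps ⊕ word t r pt)            ≡⟨ eval-⊕ μ _ _ ⟩
      eval μ (word s r ps) · eval μ (word t r pt)   ≡⟨ cong₂ _·_ (eval-word s r ps) (eval-word t r pt) ⟩
      _                                             ≡⟨ e ⟩
      _                                             ∎
      where open ≡-Reasoning
    eval-word (omg t)  r (_ , _ , (n , pu) , (n′ , pv) , e) = begin
      eval μ (cat (blocks t r (suc n) pu) ⊕ ω-power (cat (blocks t r (suc n′) pv)))
        ≡⟨ eval-⊕ μ _ _ ⟩
      eval μ (cat (blocks t r (suc n) pu)) · eval μ (ω-power (cat (blocks t r (suc n′) pv)))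
        ≡⟨ cong (eval μ (cat (blocks t r (suc n) pu)) ·_) (eval-ω μ _) ⟩
      eval μ (cat (blocks t r (suc n) pu)) · (eval μ (cat (blocks t r (suc n′) pv)) ^ω)
        ≡⟨ cong₂ (λ x y → x · (y ^ω)) (eval-blocks t r (suc n) pu) (eval-blocks t r (suc n′) pv) ⟩
      _ ≡⟨ e ⟩
      _ ∎
      where open ≡-Reasoning
    eval-word (mrg t)  r (k , N , pow) = eval-blocks t r (mergeExponent r k N) (atMergeExponent r k N pow)

    eval-blocks : ∀ t r j {m} (pm : powP ⟦ t ⟧ₛ j m) → eval μ (cat (blocks t r j pm)) ≡ m
    eval-blocks t r zero       m≡𝟙 = ≡-trans (eval-ε μ) (sym m≡𝟙)
    eval-blocks t r (suc zero) pt  = ≡-trans (eval-cong μ (⊕-identityʳ (word t r pt))) (eval-word t r pt)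
    eval-blocks t r (suc (suc j)) (_ , _ , pj , pt , e) = begin
      eval μ (cat (blocks t r (suc j) pj ++ word t r pt ∷ []))
        ≡⟨ eval-cat-∷ʳ μ (blocks t r (suc j) pj) (word t r pt) ⟩
      eval μ (cat (blocks t r (suc j) pj)) · eval μ (word t r pt)
        ≡⟨ cong₂ _·_ (eval-blocks t r (suc j) pj) (eval-word t r pt) ⟩
      _ ≡⟨ e ⟩
      _ ∎
      where open ≡-Reasoning

  IsWord : SatTerm M μ → ℕ → Word Σ′ → Set₁
  IsWord t r x = Σ Carrier λ m → Σ (⟦ t ⟧ₛ m) λ pm → word t r pm ≡ x

  blocks-IsWord : ∀ t r j {m} (pm : powP ⟦ t ⟧ₛ j m) → All (IsWord t r) (blocks t r j pm)
  blocks-IsWord t r zero          _                     = []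
  blocks-IsWord t r (suc zero)    pt                    = (_ , pt , refl) ∷ []
  blocks-IsWord t r (suc (suc j)) (_ , _ , pj , pt , _) =
    ++⁺ (blocks-IsWord t r (suc j) pj) ((_ , pt , refl) ∷ [])

  length-blocks : ∀ t r j {m} (pm : powP ⟦ t ⟧ₛ j m) → length (blocks t r j pm) ≡ j
  length-blocks t r zero          _                     = refl
  length-blocks t r (suc zero)    _                     = refl
  length-blocks t r (suc (suc j)) (_ , _ , pj , _ , _) =
    ≡-trans (length-++ (blocks t r (suc j) pj))
            (≡-trans (cong (_+ 1) (length-blocks t r (suc j) pj)) (+-comm (suc j) 1))

  powP-witness : ∀ t n {m} → powP ⟦ t ⟧ₛ (suc n) m → Σ Carrier ⟦ t ⟧ₛ
  powP-witness t zero    {m} pm            = m , pm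
  powP-witness t (suc n) (_ , _ , pn , _ , _) = powP-witness t n pn

  mutual
    ∼-word : ∀ t r {m m′} (pm : ⟦ t ⟧ₛ m) (pm′ : ⟦ t ⟧ₛ m′) → word t r pm ∼[ r ] word t r pm′
    ∼-word unit     r _ _ = EF-refl r emptyW ⊥-elim
    ∼-word (lett a) r _ _ = EF-refl r (oneW a) ⊥-elim
    ∼-word (s ⊗ t)  r (_ , _ , ps , pt , _) (_ , _ , ps′ , pt′ , _) =
      ∼-⊕ (∼-word s r ps ps′) (∼-word t r pt pt′)
    ∼-word (omg t)  r pm@(_ , _ , (n , pu) , _) pm′ =
      EF-trans (∼-word-ω t r z (_ , pz , refl) pm) (∼-sym (∼-word-ω t r z (_ , pz , refl) pm′))
      where
      pz : ⟦ t ⟧ₛ (proj₁ (powP-witness t n pu))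
      pz = proj₂ (powP-witness t n pu)
      z : Word Σ′
      z = word t r pz
    ∼-word (mrg t)  r (k , N , pow) (k′ , N′ , pow′) =
      ∼-cat (IsWord t r) r (uniform t r)
            (blocks-IsWord t r (mergeExponent r k N) (atMergeExponent r k N pow))
            (blocks-IsWord t r (mergeExponent r k′ N′) (atMergeExponent r k′ N′ pow′))
            (inj₂ (many k N pow , many k′ N′ pow′))
      where
      many : ∀ k N {m} (pow : ∀ n → N ≤ n → powP ⟦ t ⟧ₛ (n ! + k) m) →
             threshold r ≤ length (blocks t r (mergeExponent r k N) (atMergeExponent r k N pow))
      many k N pow = ≤-trans (threshold≤mergeExponent r k N)
                             (≤-reflexive (sym (length-blocks t r _ (atMergeExponent r k N pow))))

    uniform : ∀ t r → Uniform (IsWord t r) r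
    uniform t r (_ , pm , refl) (_ , pm′ , refl) = ∼-word t r pm pm′

    -- u and v are r-equivalent to powers of z, and z^(n+1) (z^(n′+1))^ω ≅ z^ω.
    ∼-word-ω : ∀ t r z → IsWord t r z → ∀ {m} (pm : ⟦ omg t ⟧ₛ m) → word (omg t) r pm ∼[ r ] ω-power z
    ∼-word-ω t r z Pz (_ , _ , (n , pu) , (n′ , pv) , _) =
      ∼-transport ≅-refl (≅-trans (⊕-cong ≅-refl (ω-regroup z (suc n′))) (power-⊕-ω z (suc n)))
        (∼-⊕ (to-power n pu) (∼-ω-power (to-power n′ pv)))
      where
      to-power : ∀ n {m} (p : powP ⟦ t ⟧ₛ (suc n) m) → cat (blocks t r (suc n) p) ∼[ r ] power z (suc n)
      to-power n p = ∼-cat (IsWord t r) r (uniform t r) (blocks-IsWord t r (suc n) p) (replicate⁺ (suc n) Pz)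
                           (inj₁ (≡-trans (length-blocks t r (suc n) p) (sym (length-replicate (suc n)))))

mainTheorem4 : (M : FiniteOrdinalMonoid) (Σ' : Set) → IsFinite Σ' →
    (μ : Σ' → FiniteOrdinalMonoid.Carrier M) →
    (FK FL : Pred (FiniteOrdinalMonoid.Carrier M) 0ℓ) →
    (Σ (Pred (FiniteOrdinalMonoid.Carrier M) 0ℓ) λ X → InSat M μ X
       × (Σ (FiniteOrdinalMonoid.Carrier M) λ m → X m × FK m)
       × (Σ (FiniteOrdinalMonoid.Carrier M) λ m → X m × FL m)) →
    (Σ (Sentence Σ' → Word Σ' × Word Σ') λ f → ∀ φ →
         Recognised M μ FK (proj₁ (f φ)) × Recognised M μ FL (proj₂ (f φ))
       × ((proj₁ (f φ) ⊨ φ → proj₂ (f φ) ⊨ φ) × (proj₂ (f φ) ⊨ φ → proj₁ (f φ) ⊨ φ)))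
    × ((Σ (Sentence Σ') λ φ → (∀ u → Recognised M μ FK u → u ⊨ φ)
                            × (∀ u → Recognised M μ FL u → u ⊨ φ → ⊥)) → ⊥)
mainTheorem4 M Σ' _ μ FK FL (X , (t , X≐⟦t⟧) , (mK , X-mK , FK-mK) , (mL , X-mL , FL-mL)) =
  (words , correct) , λ (φ , K⊨φ , L⊭φ) → let K-u , L-u′ , u⇒u′ , _ = correct φ in L⊭φ _ L-u′ (u⇒u′ (K⊨φ _ K-u))
  where
  open SatWords M μ
  pK : ⟦ t ⟧ₛ mK
  pK = proj₂ (X≐⟦t⟧ mK) X-mK
  pL : ⟦ t ⟧ₛ mL
  pL = proj₂ (X≐⟦t⟧ mL) X-mL
  words : Sentence Σ' → Word Σ' × Word Σ'
  words φ = word t (rank φ) pK , word t (rank φ) pL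
  correct : ∀ φ → Recognised M μ FK (proj₁ (words φ)) × Recognised M μ FL (proj₂ (words φ))
                × ((proj₁ (words φ) ⊨ φ → proj₂ (words φ) ⊨ φ) × (proj₂ (words φ) ⊨ φ → proj₁ (words φ) ⊨ φ))
  correct φ = subst FK (sym (eval-word t (rank φ) pK)) FK-mK , subst FL (sym (eval-word t (rank φ) pL)) FL-mL
            , ∼-sound φ (∼-word t (rank φ) pK pL)
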